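{- Any derived set of a uniformly recurrent tree set is a uniformly recurrent tree set. That is: let $S\subset A^*$ be a uniformly recurrent tree set, let $w\in S$, and let $f:B^*\to A^*$ be a coding morphism for the set $\mathcal{R}_S(w)$ of first right return words to $w$. Then the derived set $D_f(S)=f^{ -1}(w^{ -1}S)\subset B^*$ is a uniformly recurrent tree set.
   Context: Words and sets. $A$ is a finite nonempty alphabet, $A^*$ the free monoid of finite words over $A$, $A^+$ the set of nonempty words. A set $S$ of words is factorial if it contains all factors of its elements. A factorial set $S$ is right-extendable if for every $w\in S$ there is a letter $a$ with $wa\in S$, and biextendable if for every $w\in S$ there are letters $a,b$ with $awb\in S$. A set $S$ is uniformly recurrent if it is (nonempty) factorial and right-extendable and for every $u\in S$ there is $n\ge 1$ such that $u$ is a factor of every word of $S$ of length $n$. For a word $w$, $w^{ -1}S=\{y\in A^*\mid wy\in S\}$. Tree sets. For a factorial set $S$ and $w\in S$, let $L(w)=\{a\in A\mid aw\in S\}$, $R(w)=\{a\in A\mid wa\in S\}$, $E(w)=\{(a,b)\in A\times A\mid awb\in S\}$. The extension graph $G(w)$ is the undirected graph whose vertex set is the disjoint union of $L(w)$ and $R(w)$ and whose edges are the pairs $(a,b)\in E(w)$ (joining $a\in L(w)$ to $b\in R(w)$). $S$ is a tree set if it is factorial, biextendable, and for every $w\in S$ (including the empty word) the graph $G(w)$ is a tree, i.e. connected and acyclic. Return words. For $w\in S$, $\Gamma_S(w)=\{x\in S\mid wx\in S\cap A^+w\}$ is the set of right return words to $w$, and $\mathcal{R}_S(w)=\Gamma_S(w)\setminus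 \Gamma_S(w)A^+$ is the set of first right return words to $w$ (it is a prefix code). A coding morphism for a code $X\subset A^+$ is a monoid morphism $f:B^*\to A^*$ which maps the alphabet $B$ bijectively onto $X$. -}

module Defs where

open import Level using (Level; _⊔_) renaming (suc to lsuc)
open import Algebra.Morphism.Structures using (IsMonoidHomomorphism)
open import Data.List.Base using (List; []; _∷_; [_]; _++_; _∷ʳ_; length; ++-[]-rawMonoid)
open import Data.List.Relation.Binary.Infix.Heterogeneous using (Infix)
open import Data.List.Relation.Unary.Linked using (Linked)
open import Data.List.Relation.Unary.Unique.Propositional using (Unique)
open import Data.Nat.Base using (ℕ; _≤_)
open import Data.Product.Base using (_×_; _,_; ∃; ∃-syntax; ∃₂)
open import Data.Sum.Base using (_⊎_; inj₁; inj₂)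
open import Relation.Binary.Construct.Closure.ReflexiveTransitive using (Star)
open import Relation.Binary.Core using (Rel)
open import Relation.Binary.Definitions using (Symmetric)
open import Relation.Binary.PropositionalEquality.Core using (_≡_; _≢_)
open import Relation.Nullary.Negation.Core using (¬_)
open import Relation.Unary using (Pred; _∈_; _∩_; _∖_; _⊢_; ｛_｝; Satisfiable; _⟨⊎⟩_)

private
  variable
    a b ℓ ℓ′ : Level
    A : Set a
    B : Set b

------------------------------------------------------------------------
-- Words and sets of words

Language : Set a → (ℓ : Level) → Set (a ⊔ lsuc ℓ)
Language A ℓ = Pred (List A) ℓ

_isFactorOf_ : {A : Set a} → Rel (List A) a
_isFactorOf_ = Infix _≡_

_⁺ : (A : Set a) → Language A a
(A ⁺) x = x ≢ []

infixr 8 _·_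

_·_ : {A : Set a} → Language A ℓ → Language A ℓ′ → Language A (a ⊔ ℓ ⊔ ℓ′)
(X · Y) z = ∃₂ λ x y → x ∈ X × y ∈ Y × z ≡ x ++ y

infixr 8 _⁻¹_

_⁻¹_ : List A → Language A ℓ → Language A ℓ
w ⁻¹ S = (w ++_) ⊢ S

Factorial : {A : Set a} → Language A ℓ → Set (a ⊔ ℓ)
Factorial S = ∀ {u w} → w ∈ S → u isFactorOf w → u ∈ S

RightExtendable : {A : Set a} → Language A ℓ → Set (a ⊔ ℓ)
RightExtendable S = ∀ {w} → w ∈ S → ∃[ a ] w ∷ʳ a ∈ S

Biextendable : {A : Set a} → Language A ℓ → Set (a ⊔ ℓ)
Biextendable S = ∀ {w} → w ∈ S → ∃₂ λ a b → a ∷ (w ∷ʳ b) ∈ S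

record UniformlyRecurrent {A : Set a} (S : Language A ℓ) : Set (a ⊔ ℓ) where
  field
    nonempty        : Satisfiable S
    factorial       : Factorial S
    rightExtendable : RightExtendable S
    recurrent       : ∀ {u} → u ∈ S →
                      ∃[ n ] 1 ≤ n × (∀ {v} → v ∈ S → length v ≡ n → u isFactorOf v)

------------------------------------------------------------------------
-- Undirected graphs

-- The vertices are singled out by a predicate on an ambient type, rather than
-- forming a Σ-type, so that different proofs of membership in the (possibly
-- proof-relevant) vertex set do not give different vertices.
record Graph (V : Set a) (p ℓ : Level) : Set (a ⊔ lsuc (p ⊔ ℓ)) where
  field
    Vertex    : Pred V p
    Adjacent  : Rel V ℓ
    symmetric : Symmetric Adjacent

module _ {V : Set a} {p ℓ : Level} (G : Graph V p ℓ) where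
  open Graph G

  Connected : Set (a ⊔ p ⊔ ℓ)
  Connected = ∀ {x y} → x ∈ Vertex → y ∈ Vertex → Star Adjacent x y

  -- A cycle x₀, x₁, …, xₖ (k ≥ 2) lists its distinct vertices; xₖ is adjacent to x₀.
  IsCycle : V → List V → Set (a ⊔ ℓ)
  IsCycle x₀ xs = 2 ≤ length xs × Unique (x₀ ∷ xs) × Linked Adjacent (x₀ ∷ (xs ∷ʳ x₀))

  Acyclic : Set (a ⊔ ℓ)
  Acyclic = ∀ x₀ xs → ¬ IsCycle x₀ xs

  IsTree : Set (a ⊔ p ⊔ ℓ)
  IsTree = Connected × Acyclic

------------------------------------------------------------------------
-- Extension graphs and tree sets

module _ {A : Set a} (S : Language A ℓ) (w : List A) where

  L : Pred A ℓ
  L a = a ∷ w ∈ S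

  R : Pred A ℓ
  R b = w ∷ʳ b ∈ S

  E : Pred (A × A) ℓ
  E (a , b) = a ∷ (w ∷ʳ b) ∈ S

  -- When S is factorial, (a , b) ∈ E entails a ∈ L and b ∈ R, so adjacent
  -- elements of A ⊎ A are automatically vertices of the extension graph.
  data ExtensionAdjacent : Rel (A ⊎ A) (a ⊔ ℓ) where
    left-right : ∀ {a b} → (a , b) ∈ E → ExtensionAdjacent (inj₁ a) (inj₂ b)
    right-left : ∀ {a b} → (a , b) ∈ E → ExtensionAdjacent (inj₂ b) (inj₁ a)

  extensionGraph : Graph (A ⊎ A) ℓ (a ⊔ ℓ)
  extensionGraph = record
    { Vertex    = L ⟨⊎⟩ R
    ; Adjacent  = ExtensionAdjacent
    ; symmetric = λ where
        (left-right e) → right-left e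
        (right-left e) → left-right e
    }

record TreeSet {A : Set a} (S : Language A ℓ) : Set (a ⊔ ℓ) where
  field
    factorial    : Factorial S
    biextendable : Biextendable S
    trees        : ∀ {w} → w ∈ S → IsTree (extensionGraph S w)

record UniformlyRecurrentTreeSet {A : Set a} (S : Language A ℓ) : Set (a ⊔ ℓ) where
  field
    uniformlyRecurrent : UniformlyRecurrent S
    treeSet            : TreeSet S

------------------------------------------------------------------------
-- Return words and derived sets

module _ {A : Set a} (S : Language A ℓ) (w : List A) where

  ReturnWord : Language A (a ⊔ ℓ)
  ReturnWord = S ∩ (w ⁻¹ (S ∩ (A ⁺ · ｛ w ｝)))

  FirstReturnWord : Language A (a ⊔ ℓ)
  FirstReturnWord = ReturnWord ∖ (ReturnWord · A ⁺)

-- That X is a code is not a field: the set of first right return words, the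
-- only X considered, is always a prefix code.
record IsCodingMorphism {A : Set a} {B : Set b}
                        (X : Language A ℓ) (f : List B → List A) : Set (a ⊔ b ⊔ ℓ) where
  field
    isMonoidHomomorphism : IsMonoidHomomorphism (++-[]-rawMonoid B) (++-[]-rawMonoid A) f
    into                 : ∀ β → f [ β ] ∈ X
    injective            : ∀ {β γ} → f [ β ] ≡ f [ γ ] → β ≡ γ
    onto                 : ∀ {x} → x ∈ X → ∃[ β ] f [ β ] ≡ x

DerivedSet : Language A ℓ → List A → (List B → List A) → Language B ℓ
DerivedSet S w f = f ⊢ (w ⁻¹ S)

{-# OPTIONS --safe #-}

-- For a tree set S and complete finite codes U, V, the bipartite graph joining u ∈ U to v ∈ V when
-- u z v ∈ S is again a tree: peeling off one letter of the code exhibits it as a tree whose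
-- vertices on one side are replaced by trees.  The extension graph of x in the derived set is this
-- graph for z = w f(x), where V is the set of first right return words to w and U the set of first
-- left return words, because w f(β) = u w for a unique u ∈ U.  Membership in S is undecidable in
-- general, so U and V are cut out of the tree of all words by the decidable condition of ending
-- in w (resp. starting with w), with a depth bound given by uniform recurrence; leaves which do not
-- extend to words of S are harmless since they meet no edge.

module Submission where

open import Defs
open import Level using (Level; _⊔_)
open import Algebra.Morphism.Structures using (IsMonoidHomomorphism)
open import Data.Fin.Base using (Fin)
import Data.Fin.Properties as Fin
open import Data.List.Base using (List; []; _∷_; [_]; _++_; _∷ʳ_; _ʳ++_; length; reverse; take; drop)
open import Data.List.Properties
open import Data.List.Membership.Propositional using () renaming (_∈_ to _∈ₗ_)
open import Data.List.Membership.DecPropositional using (_∈?_)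
open import Data.List.Relation.Binary.Infix.Heterogeneous using (MkView; toView; fromView; _++ⁱ_; _ⁱ++_)
open import Data.List.Relation.Binary.Pointwise using (Pointwise-≡⇒≡; ≡⇒Pointwise-≡)
open import Data.List.Relation.Unary.All as All using (All; []; _∷_)
open import Data.List.Relation.Unary.All.Properties using (¬Any⇒All¬)
open import Data.List.Relation.Unary.AllPairs using ([]; _∷_)
open import Data.List.Relation.Unary.Any using (here; there)
open import Data.List.Relation.Unary.Linked using (Linked; []; [-]; _∷_)
open import Data.List.Relation.Unary.Unique.Propositional using (Unique)
open import Data.Nat.Base using (ℕ; zero; suc; _+_; _≤_; z≤n; s≤s)
open import Data.Nat.Properties
  using ( suc-injective; +-assoc; +-comm; +-cancelʳ-≡; m+n≡0⇒m≡0; m+n≡0⇒n≡0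
        ; ≤-reflexive; ≤-trans; ≤-total; +-mono-≤; m≤n⇒m⊓n≡m )
open import Data.Product.Base using (Σ; _×_; _,_; proj₁; proj₂; ∃-syntax; ∃₂)
open import Data.Sum.Base as Sum using (_⊎_; inj₁; inj₂)
open import Data.Sum.Properties using (inj₁-injective; inj₂-injective)
import Data.Sum.Properties as Sum
open import Data.Unit.Polymorphic.Base using (⊤; tt)
open import Function.Base using (_∘_; flip)
open import Function.Bundles using (_↔_)
open import Function.Properties.Inverse using (↔⇒↣)
open import Relation.Binary.Construct.Closure.ReflexiveTransitive
  using (Star; ε; _◅_; _◅◅_; gmap)
  renaming (reverse to reverseStar)
open import Relation.Binary.Core using (REL; Rel)
open import Relation.Binary.Definitions using (Symmetric; DecidableEquality)
open import Relation.Binary.PropositionalEquality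
  using (_≡_; _≢_; refl; sym; trans; cong; cong₂; subst; module ≡-Reasoning)
open import Relation.Nullary.Decidable using (Dec; yes; no; map′; _×-dec_; via-injection)
open import Relation.Nullary.Negation.Core using (¬_; contradiction)
open import Relation.Unary using (Pred; Decidable; _∈_; _⟨⊎⟩_)

private
  variable
    a b c d r r′ ℓ : Level
    A B : Set a

-- Bipartite graphs

data Step {X : Set a} {Y : Set b} (G : REL X Y r) : Rel (X ⊎ Y) (a ⊔ b ⊔ r) where
  across : ∀ {x y} → G x y → Step G (inj₁ x) (inj₂ y)
  back   : ∀ {x y} → G x y → Step G (inj₂ y) (inj₁ x)

Walk : {X : Set a} {Y : Set b} → REL X Y r → Rel (X ⊎ Y) (a ⊔ b ⊔ r)
Walk G = Star (Step G)

Without : {X : Set a} {Y : Set b} → REL X Y r → X → Y → REL X Y (a ⊔ b ⊔ r)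
Without G x y x′ y′ = G x′ y′ × ¬ (x′ ≡ x × y′ ≡ y)

-- Acyclicity is phrased as "every edge is a bridge"; vertices without edges are ignored.
record Tree {X : Set a} {Y : Set b} (G : REL X Y r) : Set (a ⊔ b ⊔ r) where
  field
    linked : ∀ {x x′ y y′} → G x y → G x′ y′ → Walk G (inj₁ x) (inj₁ x′)
    bridge : ∀ {x y} → G x y → ¬ Walk (Without G x y) (inj₁ x) (inj₂ y)

open Tree

private
  variable
    X X′ : Set a
    Y Y′ : Set b
    G : REL X Y r
    G′ : REL X′ Y′ r′

step-sym : Symmetric (Step G)
step-sym (across e) = back e
step-sym (back e)   = across e

step-map : (g : X′ → X) (h : Y′ → Y) → (∀ {x y} → G′ x y → G (g x) (h y)) →
           ∀ {p q} → Step G′ p q → Step G (Sum.map g h p) (Sum.map g h q)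
step-map g h f (across e) = across (f e)
step-map g h f (back e)   = back (f e)

step-swap : (∀ {x y} → G′ y x → G x y) → ∀ {p q} → Step G′ p q → Step G (Sum.swap p) (Sum.swap q)
step-swap f (across e) = back (f e)
step-swap f (back e)   = across (f e)

-- A left vertex has at most one edge here, so removing that edge leaves no step out of it. This is
-- the base case of the inductions over codes.
star-tree : {G : REL X (⊤ {ℓ}) r} → Tree G
star-tree .linked e e′ = across e ◅ back e′ ◅ ε
star-tree .bridge e (across (_ , ≢e) ◅ _) = ≢e (refl , refl)

flip-tree : Tree G → Tree (flip G)
flip-tree t .linked e e′ =
  gmap Sum.swap (step-swap λ e → e) (back e ◅ t .linked e e′ ◅◅ across e′ ◅ ε)
flip-tree t .bridge e ps =
  t .bridge e (reverseStar step-sym (gmap Sum.swap (step-swap λ where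
    (e , ≢e) → e , λ where (refl , refl) → ≢e (refl , refl)) ps))

module _ {X : Set a} {Y : Set b} {G : REL X Y r}
         {X′ : Set c} {Y′ : Set d} {G′ : REL X′ Y′ r′}
         (g : X′ → X) (h : Y′ → Y)
         (g-inj : ∀ {x y} → g x ≡ g y → x ≡ y) (h-inj : ∀ {x y} → h x ≡ h y → x ≡ y)
         (to : ∀ {x y} → G′ x y → G (g x) (h y))
         (from : ∀ {x y} → G x y → ∃₂ λ x′ y′ → g x′ ≡ x × h y′ ≡ y × G′ x′ y′) where

  private
    lift-step : ∀ {p′ p q} → Step G p q → Sum.map g h p′ ≡ p →
                ∃[ q′ ] Sum.map g h q′ ≡ q × Step G′ p′ q′
    lift-step {inj₁ x₀} (across e) eq with from e
    ... | x , y , refl , refl , e′ with refl ← g-inj (inj₁-injective eq) = inj₂ y , refl , across e′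
    lift-step {inj₂ y₀} (back e) eq with from e
    ... | x , y , refl , refl , e′ with refl ← h-inj (inj₂-injective eq) = inj₁ x , refl , back e′

    lift-walk : ∀ {p′ p q} → Walk G p q → Sum.map g h p′ ≡ p →
                ∃[ q′ ] Sum.map g h q′ ≡ q × Walk G′ p′ q′
    lift-walk ε eq = _ , eq , ε
    lift-walk (s ◅ ps) eq with lift-step s eq
    ... | _ , eq′ , s′ with lift-walk ps eq′
    ... | q , eq″ , ps′ = q , eq″ , s′ ◅ ps′

  -- Every edge of `G` comes from `G′`, so a walk of `G` that starts in the image never leaves it
  -- and can be lifted. Vertices of `G` outside the image carry no edge.
  embedded-tree : Tree G → Tree G′
  embedded-tree t .linked {x} {x′} e e′ with lift-walk {inj₁ x} (t .linked (to e) (to e′)) refl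
  ... | inj₁ _ , eq , ps with refl ← g-inj (inj₁-injective eq) = ps
  embedded-tree t .bridge e ps = t .bridge (to e) (gmap (Sum.map g h) (step-map g h λ where
    (e′ , ≢e) → to e′ , λ where (p , q) → ≢e (g-inj p , h-inj q)) ps)

-- K is obtained from the tree H by replacing each vertex y with the right part of a tree
-- whose left part is the neighbourhood of y.  A walk of K that leaves the fibre of y re-enters
-- it at the same neighbour, for otherwise H would have a cycle through y; so a cycle of K would
-- shrink to a cycle in one fibre.
module _ {X : Set a} {Y : Set b} {V : Y → Set c}
         (_≟ˣ_ : DecidableEquality X) (_≟ʸ_ : DecidableEquality Y)
         {H : REL X Y r} {K : REL X (Σ Y V) r′}
         (project : ∀ {x y v} → K x (y , v) → H x y)
         (lift    : ∀ {x y} → H x y → ∃[ v ] K x (y , v))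
         (base    : Tree H)
         (fibre   : ∀ y → Tree λ x v → K x (y , v)) where

  private
    into-fibre : ∀ y {p q} → Step (λ x v → K x (y , v)) p q →
                 Step K (Sum.map₂ (y ,_) p) (Sum.map₂ (y ,_) q)
    into-fibre y = step-map (λ x → x) (y ,_) (λ e → e)

    -- A detour `x`, `y`, `x′` of `H` becomes a walk inside the fibre of `y`, where `lift` gives
    -- both ends an edge.
    lift-walk : ∀ {x x′} → Walk H (inj₁ x) (inj₁ x′) → Walk K (inj₁ x) (inj₁ x′)
    lift-walk ε = ε
    lift-walk (across {y = y} e ◅ back e′ ◅ ps) =
      gmap (Sum.map₂ (y ,_)) (into-fibre y) (fibre y .linked (proj₂ (lift e)) (proj₂ (lift e′)))
      ◅◅ lift-walk ps

    Off : Y → REL X Y _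
    Off y₀ x y = H x y × y ≢ y₀

    -- Otherwise the walk, followed by the edge from `x′` to `y₀`, would bypass the edge from `x` to
    -- `y₀`.
    re-entry : ∀ {y₀ x x′} → H x y₀ → H x′ y₀ → Walk (Off y₀) (inj₁ x) (inj₁ x′) → x ≡ x′
    re-entry {y₀} {x} {x′} e e′ ps with x ≟ˣ x′
    ... | yes x≡x′ = x≡x′
    ... | no  x≢x′ = contradiction
      (gmap (λ p → p) avoid ps ◅◅ across (e′ , λ where (x′≡x , _) → x≢x′ (sym x′≡x)) ◅ ε)
      (base .bridge e)
      where
      avoid : ∀ {p q} → Step (Off y₀) p q → Step (Without H x y₀) p q
      avoid (across (e , ≢y₀)) = across (e , ≢y₀ ∘ proj₂)
      avoid (back   (e , ≢y₀)) = back   (e , ≢y₀ ∘ proj₂)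

    module _ (x₀ : X) (y₀ : Y) (v₀ : V y₀) where

      Rest : REL X (Σ Y V) _
      Rest = Without K x₀ (y₀ , v₀)

      InFibre : Rel (X ⊎ V y₀) _
      InFibre = Walk λ x v → Rest x (y₀ , v)

      -- A normal form for walks to `(y₀ , v₀)`: at most one excursion outside the fibre of `y₀`,
      -- then a stretch inside it. The excursion is kept only as a walk of `H`, which is all that
      -- `re-entry` needs.
      data Reduced : X ⊎ Σ Y V → Set (a ⊔ b ⊔ c ⊔ r ⊔ r′) where
        inside  : ∀ {v} → InFibre (inj₂ v) (inj₂ v₀) → Reduced (inj₂ (y₀ , v))
        through : ∀ {p x} → Walk (Off y₀) (Sum.map₂ proj₁ p) (inj₁ x) → H x y₀ →
                  InFibre (inj₁ x) (inj₂ v₀) → Reduced p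

      reduce : ∀ {p} → Walk Rest p (inj₂ (y₀ , v₀)) → Reduced p
      reduce ε = inside ε
      reduce (across e ◅ ps) with reduce ps
      ... | inside qs = through ε (project (proj₁ e)) (across e ◅ qs)
      -- The excursion leaves from a right vertex, so it has a first step, which certifies that this
      -- vertex differs from `y₀`; hence `e` can be put in front.
      ... | through (back (e′ , ≢y₀) ◅ os) e″ qs =
        through (across (project (proj₁ e) , ≢y₀) ◅ back (e′ , ≢y₀) ◅ os) e″ qs
      reduce (back {y = y , v} e ◅ ps) with reduce ps
      ... | through os e″ qs with y ≟ʸ y₀
      ...   | no  ≢y₀ = through (back (project (proj₁ e) , ≢y₀) ◅ os) e″ qs
      -- By `re-entry` the excursion returns to the neighbour of `y₀` at which it left, so it is
      -- dropped.
      ...   | yes refl with refl ← re-entry (project (proj₁ e)) e″ os = inside (back e ◅ qs)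

  composed-tree : Tree K
  composed-tree .linked e e′ = lift-walk (base .linked (project e) (project e′))
  composed-tree .bridge {x₀} {y₀ , v₀} e ps with reduce x₀ y₀ v₀ ps
  -- A walk from a left vertex can only reduce to `through`. Its excursion closes up at `x₀`, which
  -- leaves a walk within one fibre that avoids `e`.
  ... | through os e″ qs with refl ← re-entry (project e) e″ os =
    fibre y₀ .bridge e (gmap (λ p → p) avoid qs)
    where
    avoid : ∀ {p q} → Step (λ x v → Rest x₀ y₀ v₀ x (y₀ , v)) p q →
            Step (Without (λ x v → K x (y₀ , v)) x₀ v₀) p q
    avoid (across (k , ≢e)) = across (k , λ where (refl , refl) → ≢e (refl , refl))
    avoid (back   (k , ≢e)) = back   (k , λ where (refl , refl) → ≢e (refl , refl))

-- Cycles and bridges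

data Path {V : Set a} (T : Rel V r) : V → V → List V → Set (a ⊔ r) where
  []  : ∀ {x} → Path T x x []
  _∷_ : ∀ {x y z xs} → T x y → Path T y z xs → Path T x z (y ∷ xs)

module _ {V : Set a} {T : Rel V r} where

  cut-at : ∀ {p x y xs} → Path T x y xs → Unique (x ∷ xs) → p ∈ₗ x ∷ xs →
           ∃[ ys ] Path T p y ys × Unique (p ∷ ys)
  cut-at ps       u       (here refl) = _ , ps , u
  cut-at (_ ∷ ps) (_ ∷ u) (there i)   = cut-at ps u i

  -- Loop erasure: if the start recurs on the simple path found for the rest of the walk, that path
  -- is cut at the recurrence.
  simple-path : DecidableEquality V → ∀ {x y} → Star T x y →
                ∃[ xs ] Path T x y xs × Unique (x ∷ xs)
  simple-path _≟_ ε = [] , [] , [] ∷ []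
  simple-path _≟_ {x} (_◅_ {j = y} t ts) with simple-path _≟_ ts
  ... | ys , ps , u with _∈?_ _≟_ x (y ∷ ys)
  ...   | yes i = cut-at ps u i
  ...   | no ∉  = y ∷ ys , t ∷ ps , ¬Any⇒All¬ _ ∉ ∷ u

  close : ∀ {T′ : Rel V r′} → (∀ {x y} → T x y → T′ x y) → ∀ {x y z xs} →
          Path T x y xs → T′ y z → Linked T′ (x ∷ xs ∷ʳ z)
  close f []       t′ = t′ ∷ [-]
  close f (t ∷ ps) t′ = f t ∷ close f ps t′

  Avoiding : V → Rel V (a ⊔ r)
  Avoiding o x y = T x y × x ≢ o × y ≢ o

  -- Opens a cycle at `o`, with `z` the predecessor of `o`. Recording that `z` is in the list lets
  -- uniqueness separate it from the successor of `o`.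
  arc : ∀ {o x xs} → Linked T (x ∷ xs ∷ʳ o) → All (o ≢_) (x ∷ xs) →
        ∃[ z ] z ∈ₗ x ∷ xs × Star (Avoiding o) x z × T z o
  arc {xs = []}    (t ∷ [-]) _ = _ , here refl , ε , t
  arc {xs = _ ∷ _} (t ∷ ts) (n ∷ ns@(n′ ∷ _)) with arc ts ns
  ... | z , i , ps , t′ = z , there i , (t , n ∘ sym , n′ ∘ sym) ◅ ps , t′

-- Extension graphs: acyclicity by cycles against acyclicity by bridges

module _ {A : Set a} (S : Language A ℓ) (w : List A) where

  Extends : REL A A ℓ
  Extends x y = x ∷ (w ∷ʳ y) ∈ S

  private
    toAdjacent : ∀ {p q} → Step Extends p q → ExtensionAdjacent S w p q
    toAdjacent (across e) = left-right e
    toAdjacent (back e)   = right-left e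

    fromAdjacent : ∀ {p q} → ExtensionAdjacent S w p q → Step Extends p q
    fromAdjacent (left-right e) = across e
    fromAdjacent (right-left e) = back e

    avoidˡ : ∀ {x y p q} → Avoiding {T = ExtensionAdjacent S w} (inj₁ x) p q →
             Step (Without Extends x y) p q
    avoidˡ (left-right e , n , _) = across (e , λ where (refl , _) → n refl)
    avoidˡ (right-left e , _ , n) = back   (e , λ where (refl , _) → n refl)

    avoidʳ : ∀ {x y p q} → Avoiding {T = ExtensionAdjacent S w} (inj₂ y) p q →
             Step (Without Extends x y) p q
    avoidʳ (left-right e , _ , n) = across (e , λ where (_ , refl) → n refl)
    avoidʳ (right-left e , n , _) = back   (e , λ where (_ , refl) → n refl)

  -- A walk that bypasses an edge can be made simple. A single step would be the removed edge
  -- itself, so there are at least two, and the edge closes them to a cycle.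
  extension-tree : DecidableEquality A → (∀ {x y} → Extends x y → L S w x) →
                   IsTree (extensionGraph S w) → Tree Extends
  extension-tree _≟_ left (connected , acyclic) .linked e e′ =
    gmap (λ p → p) fromAdjacent (connected (left e) (left e′))
  extension-tree _≟_ left (connected , acyclic) .bridge e ps with simple-path (Sum.≡-dec _≟_ _≟_) ps
  ... | _ , across (_ , ≢e) ∷ [] , _ = ≢e (refl , refl)
  ... | _ , qs@(_ ∷ _ ∷ _) , u =
    acyclic _ _ (s≤s (s≤s z≤n) , u , close (toAdjacent ∘ forget) qs (right-left e))
    where
    forget : ∀ {x y p q} → Step (Without Extends x y) p q → Step Extends p q
    forget (across (e , _)) = across e
    forget (back   (e , _)) = back e

  -- Isolated vertices are invisible to `Tree`; the first two hypotheses rule them out, so that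
  -- every vertex reaches the left end of some edge.
  tree-extension : (∀ {x} → L S w x → ∃[ y ] Extends x y) → (∀ {y} → R S w y → ∃[ x ] Extends x y) →
                   Tree Extends → IsTree (extensionGraph S w)
  tree-extension toRight toLeft t = connected , acyclic
    where
    reach : ∀ {p} → p ∈ (L S w ⟨⊎⟩ R S w) →
            ∃₂ λ x y → Extends x y × Star (ExtensionAdjacent S w) p (inj₁ x)
    reach {inj₁ x} l with toRight l
    ... | y , e = x , y , e , ε
    reach {inj₂ y} r with toLeft r
    ... | x , e = x , y , e , right-left e ◅ ε

    connected : Connected (extensionGraph S w)
    connected p∈ q∈ with reach p∈ | reach q∈
    ... | _ , _ , e , ps | _ , _ , e′ , qs =
      ps ◅◅ gmap (λ p → p) toAdjacent (t .linked e e′)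
         ◅◅ reverseStar (Graph.symmetric (extensionGraph S w)) qs

    acyclic : Acyclic (extensionGraph S w)
    acyclic _ (_ ∷ []) (s≤s () , _)
    -- On a cycle `o`, `x`, `y`, ..., `z` the edge between `o` and `z` is bypassed through `x`: the
    -- step between `o` and `x` is another edge because `x` is not `z`, and the remaining steps
    -- avoid `o`.
    acyclic o (x ∷ y ∷ xs) (_ , (n ∷ ns) ∷ ms ∷ _ , s ∷ s′ ∷ l) with arc l ns
    acyclic (inj₁ _) (_ ∷ y ∷ xs) (_ , (n ∷ ns) ∷ ms ∷ _ , left-right e₀ ∷ s′ ∷ l)
      | _ , i , ps , right-left e = t .bridge e
        (across (e₀ , λ where (_ , refl) → All.lookup ms i refl)
         ◅ gmap (λ p → p) avoidˡ ((s′ , n ∘ sym , All.head ns ∘ sym) ◅ ps))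
    -- Here `o` is a right vertex, while `bridge` speaks of walks from left to right, hence the
    -- reversal.
    acyclic (inj₂ _) (_ ∷ y ∷ xs) (_ , (n ∷ ns) ∷ ms ∷ _ , right-left e₀ ∷ s′ ∷ l)
      | _ , i , ps , left-right e = t .bridge e (reverseStar step-sym
        (back (e₀ , λ where (refl , _) → All.lookup ms i refl)
         ◅ gmap (λ p → p) avoidʳ ((s′ , n ∘ sym , All.head ns ∘ sym) ◅ ps)))

-- Codes as well-founded trees

-- A `branch` has a child for every letter, so over a finite alphabet the words of the leaves form a
-- complete prefix set: each long enough word starts with exactly one of them.
data Code (A : Set a) : Set a where
  stop   : Code A
  branch : (A → Code A) → Code A

Leaf : {A : Set a} → Code A → Set a
Leaf stop       = ⊤
Leaf (branch c) = ∃[ x ] Leaf (c x)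

word : (c : Code A) → Leaf c → List A
word stop       _       = []
word (branch c) (x , l) = x ∷ word (c x) l

word-injective : (c : Code A) {l l′ : Leaf c} → word c l ≡ word c l′ → l ≡ l′
word-injective stop       _ = refl
word-injective (branch c) {x , _} {x′ , _} eq with refl ← ∷-injectiveˡ eq =
  cong (x ,_) (word-injective (c x) (∷-injectiveʳ eq))

First : {A : Set a} → Pred (List A) ℓ → Pred (List A) (a ⊔ ℓ)
First P s = P s × (∀ {t u} → s ≡ t ++ u → P t → u ≡ [])

-- Truncation at depth `n` keeps the tree well founded, at the price of leaves whose words may fail
-- `P`.
cut : {P : Pred (List A) ℓ} → Decidable P → ℕ → Code A
cut P? zero    = stop
cut P? (suc n) with P? []
... | yes _ = stop
... | no  _ = branch λ x → cut (λ s → P? (x ∷ s)) n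

first-[] : {P : Pred (List A) ℓ} → P [] → First P []
first-[] {P = P} p = p , minimal
  where
  minimal : ∀ {t u} → [] ≡ t ++ u → P t → u ≡ []
  minimal {t} eq _ = ++-conicalʳ t _ (sym eq)

first-∷ : {P : Pred (List A) ℓ} → ¬ P [] → ∀ {x s} → First (P ∘ (x ∷_)) s → First P (x ∷ s)
first-∷ {P = P} ¬p {x} {s} (p , minimal) = p , minimal′
  where
  minimal′ : ∀ {t u} → x ∷ s ≡ t ++ u → P t → u ≡ []
  minimal′ {[]}    _    q = contradiction q ¬p
  minimal′ {_ ∷ _} refl q = minimal refl q

-- Before the depth bound a leaf arises only where `P` holds. At the bound `bar` gives a prefix
-- satisfying `P`, and the failures of `P` along the branch force it to be the whole word.
leaf-first : {P : Pred (List A) ℓ} (P? : Decidable P) (n : ℕ) (l : Leaf (cut P? n)) →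
             (length (word (cut P? n) l) ≡ n → ∃₂ λ t u → word (cut P? n) l ≡ t ++ u × P t) →
             First P (word (cut P? n) l)
leaf-first {P = P} P? zero l bar with bar refl
... | [] , [] , refl , p = first-[] p
leaf-first {P = P} P? (suc n) l bar with P? []
... | yes p = first-[] p
leaf-first {P = P} P? (suc n) (x , l) bar | no ¬p =
  first-∷ ¬p first
  where
  first : First (P ∘ (x ∷_)) _
  first = leaf-first (λ s → P? (x ∷ s)) n l λ len → case-bar (bar (cong suc len))
    where
    case-bar : ∀ {s} → (∃₂ λ t u → x ∷ s ≡ t ++ u × P t) → ∃₂ λ t u → s ≡ t ++ u × P (x ∷ t)
    case-bar ([]    , _ , _    , p) = contradiction p ¬p
    case-bar (_ ∷ t , u , refl , p) = t , u , refl , p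

-- The descent along `s` cannot stop early, because no proper prefix of `s` satisfies `P`, and the
-- depth bound is not reached before `s` ends.
first-leaf : {P : Pred (List A) ℓ} (P? : Decidable P) (n : ℕ) {s : List A} →
             length s ≤ n → First P s → ∃[ l ] word (cut P? n) l ≡ s
first-leaf P? zero    {[]}    _         _ = tt , refl
first-leaf P? (suc n) {s}     len       first with P? []
first-leaf P? (suc n) {s}     len       first | yes p = tt , sym (proj₂ first {[]} refl p)
first-leaf P? (suc n) {[]}    len       first | no ¬p = contradiction (proj₁ first) ¬p
first-leaf P? (suc n) {x ∷ s} (s≤s len) first | no ¬p
  with first-leaf (λ t → P? (x ∷ t)) n len (proj₁ first , λ eq → proj₂ first (cong (x ∷_) eq))
... | l , eq = (x , l) , cong (x ∷_) eq

-- If `s` has length at least `n`, its prefix of length `n` starts with a word of `P`, which by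
-- minimality is all of `s`.
first-bounded : {P : Pred (List A) ℓ} {n : ℕ} {s : List A} →
                (∀ {t u} → s ≡ t ++ u → length t ≡ n → ∃₂ λ t′ u′ → t ≡ t′ ++ u′ × P t′) →
                First P s → length s ≤ n
first-bounded {P = P} {n} {s} bar (p , minimal) with ≤-total (length s) n
... | inj₁ s≤n = s≤n
... | inj₂ n≤s = bound (bar (sym (take++drop≡id n s)) length-start)
  where
  length-start : length (take n s) ≡ n
  length-start = trans (length-take n s) (m≤n⇒m⊓n≡m n≤s)

  bound : (∃₂ λ t u → take n s ≡ t ++ u × P t) → length s ≤ n
  bound (t , u , eq , q) = ≤-reflexive (trans (cong length s≡start) length-start)
    where
    s≡t++ : s ≡ t ++ (u ++ drop n s)
    s≡t++ = trans (sym (take++drop≡id n s)) (trans (cong (_++ drop n s) eq) (++-assoc t u _))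

    s≡start : s ≡ take n s
    s≡start = trans (sym (take++drop≡id n s))
      (trans (cong (take n s ++_) (++-conicalʳ u _ (minimal s≡t++ q))) (++-identityʳ _))

ʳ++-++-assoc : ∀ (xs {ys zs} : List A) → (xs ʳ++ ys) ++ zs ≡ xs ʳ++ (ys ++ zs)
ʳ++-++-assoc []       = refl
ʳ++-++-assoc (x ∷ xs) = ʳ++-++-assoc xs

module _ {S : Language A ℓ} (factorial : Factorial S) where

  infix-closed : ∀ xs ys zs → xs ++ (ys ++ zs) ∈ S → ys ∈ S
  infix-closed xs ys zs s∈S = factorial s∈S (fromView (MkView xs (≡⇒Pointwise-≡ refl) zs))

  suffix-closed : ∀ xs {ys} → xs ++ ys ∈ S → ys ∈ S
  suffix-closed xs {ys} s∈S =
    infix-closed xs ys [] (subst (λ s → xs ++ s ∈ S) (sym (++-identityʳ ys)) s∈S)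

  prefix-closed : ∀ {xs} ys → xs ++ ys ∈ S → xs ∈ S
  prefix-closed {xs} ys s∈S = infix-closed [] xs ys s∈S

  ʳ++-closed : ∀ xs {ys} → xs ʳ++ ys ∈ S → ys ∈ S
  ʳ++-closed xs s∈S = suffix-closed (reverse xs) (subst S (ʳ++-defn xs) s∈S)

-- Two-sided extensions by codes in a tree set

module CodeTrees {A : Set a} (_≟_ : DecidableEquality A) {S : Language A ℓ} (treeSet : TreeSet S) where
  open TreeSet treeSet

  -- Completeness of the code enters here: whichever letter biextendability offers, `branch` has a
  -- child for it.
  extendʳ : (c : Code A) → ∀ {z} → z ∈ S → ∃[ l ] z ++ word c l ∈ S
  extendʳ stop       {z} z∈S = tt , subst S (sym (++-identityʳ z)) z∈S
  extendʳ (branch c) {z} z∈S with biextendable z∈S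
  ... | x , y , e with extendʳ (c y) (suffix-closed factorial [ x ] e)
  ... | l , e′ = (y , l) , subst S (∷ʳ-++ z y _) e′

  extendˡ : (c : Code A) → ∀ {z} → z ∈ S → ∃[ l ] word c l ʳ++ z ∈ S
  extendˡ stop       z∈S = tt , z∈S
  extendˡ (branch c) z∈S with biextendable z∈S
  ... | x , y , e with extendˡ (c x) (prefix-closed factorial [ y ] e)
  ... | l , e′ = (x , l) , e′

  private
    -- Both fields of `Tree` are handed an edge. In `letters-tree` that edge supplies `z ∈ S`, as
    -- `trees` requires.
    tree-if-edge : {G : REL X Y r} → (∀ {x y} → G x y → Tree G) → Tree G
    tree-if-edge t .linked e = t e .linked e
    tree-if-edge t .bridge e = t e .bridge e

    leaf-≟ : (c : Code A) → DecidableEquality (Leaf c)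
    leaf-≟ c l l′ = map′ (word-injective c) (cong (word c)) (≡-dec _≟_ (word c l) (word c l′))

  letters-tree : ∀ z → Tree (Extends S z)
  letters-tree z = tree-if-edge λ {x} {y} e →
    extension-tree S z _≟_ (prefix-closed factorial [ _ ])
      (trees (infix-closed factorial [ x ] z [ y ] e))

  -- Leaf words are read outward from `z`, hence reversed. By induction on the code: flipping the
  -- extension graph of `z` puts the first code letters `x` on the right, and each `x` is replaced
  -- by the tree for `x ∷ z`.
  left-tree : (c : Code A) → ∀ z → Tree (λ y l → word c l ʳ++ (z ∷ʳ y) ∈ S)
  left-tree stop       z = star-tree
  left-tree (branch c) z = composed-tree _≟_ _≟_
    (λ {_} {_} {l} → ʳ++-closed factorial (word (c _) l))
    (λ {_} {x} → extendˡ (c x))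
    (flip-tree (letters-tree z))
    (λ x → left-tree (c x) (x ∷ z))

  -- Induction on `d` with `c` fixed: in the tree between leaves of `c` and single letters `y`, each
  -- `y` is replaced by the tree for `z ∷ʳ y` and the code `d y`.
  code-tree : (c d : Code A) → ∀ z → Tree (λ l m → word c l ʳ++ (z ++ word d m) ∈ S)
  code-tree c stop       z = star-tree
  code-tree c (branch d) z = composed-tree (leaf-≟ c) _≟_
    (λ {l} {y} {m} → prefix-closed factorial (word (d y) m) ∘ subst S (sym (assoc l y m)))
    (λ {l} {y} e → let m , e′ = extendʳ (d y) e in m , subst S (assoc l y m) e′)
    (flip-tree (left-tree c z))
    -- The vertex maps are identities; only the bracketing of the word changes.
    (λ y → embedded-tree (λ l → l) (λ m → m) (λ eq → eq) (λ eq → eq)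
      (λ {l} {m} → subst (λ s → word c l ʳ++ s ∈ S) (sym (∷ʳ-++ z y _)))
      (λ {l} {m} e → l , m , refl , refl , subst (λ s → word c l ʳ++ s ∈ S) (∷ʳ-++ z y _) e)
      (code-tree c (d y) (z ∷ʳ y)))
    where
    assoc : ∀ l y m → (word c l ʳ++ (z ∷ʳ y)) ++ word (d y) m ≡ word c l ʳ++ (z ++ y ∷ word (d y) m)
    assoc l y m = trans (ʳ++-++-assoc (word c l)) (cong (word c l ʳ++_) (∷ʳ-++ z y _))

-- Return words

levi : ∀ (xs : List A) {ys zs us} → xs ++ ys ≡ zs ++ us →
       (∃[ t ] zs ≡ xs ++ t × ys ≡ t ++ us) ⊎ (∃[ t ] xs ≡ zs ++ t × us ≡ t ++ ys)
levi []       eq = inj₁ (_ , refl , eq)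
levi (_ ∷ _)  {zs = []} eq = inj₂ (_ , refl , sym eq)
levi (x ∷ xs) {zs = _ ∷ zs} eq with refl ← ∷-injectiveˡ eq | levi xs {zs = zs} (∷-injectiveʳ eq)
... | inj₁ (t , refl , eq′) = inj₁ (t , refl , eq′)
... | inj₂ (t , refl , eq′) = inj₂ (t , refl , eq′)

sandwich : ∀ (w : List A) xs {ys} → w ≡ xs ++ (w ++ ys) → xs ≡ [] × ys ≡ []
sandwich w xs {ys} eq =
  length≡0 xs (m+n≡0⇒m≡0 _ sum≡0) , length≡0 ys (m+n≡0⇒n≡0 (length xs) sum≡0)
  where
  length≡0 : ∀ (zs : List A) → length zs ≡ 0 → zs ≡ []
  length≡0 [] _ = refl

  sum≡0 : length xs + length ys ≡ 0
  sum≡0 = +-cancelʳ-≡ (length w) _ 0 (begin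
    length xs + length ys + length w   ≡⟨ +-assoc (length xs) _ _ ⟩
    length xs + (length ys + length w) ≡⟨ cong (length xs +_) (+-comm (length ys) _) ⟩
    length xs + (length w + length ys) ≡⟨ cong (length xs +_) (length-++ w) ⟨
    length xs + length (w ++ ys)       ≡⟨ length-++ xs ⟨
    length (xs ++ (w ++ ys))           ≡⟨ cong length eq ⟨
    length w                           ∎)
    where open ≡-Reasoning

prefix? : DecidableEquality A → ∀ (xs zs : List A) → Dec (∃[ ys ] zs ≡ xs ++ ys)
prefix? _≟_ []       zs       = yes (zs , refl)
prefix? _≟_ (x ∷ xs) []       = no λ ()
prefix? _≟_ (x ∷ xs) (z ∷ zs) with x ≟ z | prefix? _≟_ xs zs
... | no x≢z   | _             = no λ (_ , eq) → x≢z (sym (∷-injectiveˡ eq))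
... | yes _    | no ¬p         = no λ (ys , eq) → ¬p (ys , ∷-injectiveʳ eq)
... | yes refl | yes (ys , eq) = yes (ys , cong (x ∷_) eq)

suffix? : DecidableEquality A → ∀ (ys zs : List A) → Dec (∃[ xs ] zs ≡ xs ++ ys)
suffix? _≟_ ys zs with ≡-dec _≟_ zs ys
suffix? _≟_ ys zs       | yes eq = yes ([] , eq)
suffix? _≟_ ys []       | no ≢ys = no λ where ([] , eq) → ≢ys eq
suffix? _≟_ ys (z ∷ zs) | no ≢ys with suffix? _≟_ ys zs
... | yes (xs , eq) = yes (z ∷ xs , cong (z ∷_) eq)
... | no ¬s         = no λ where
  ([]     , eq) → ≢ys eq
  (_ ∷ xs , eq) → ¬s (xs , ∷-injectiveʳ eq)

nonempty? : Decidable {A = List A} (_≢ [])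
nonempty? []      = no λ ≢[] → ≢[] refl
nonempty? (_ ∷ _) = yes λ ()

reverse-≡[] : ∀ {xs : List A} → reverse xs ≡ [] → xs ≡ []
reverse-≡[] {xs = xs} eq = trans (sym (reverse-involutive xs)) (cong reverse eq)

reverse-ʳ++ : ∀ (xs : List A) {ys} → reverse xs ʳ++ ys ≡ xs ++ ys
reverse-ʳ++ xs {ys} = trans (ʳ++-defn (reverse xs)) (cong (_++ ys) (reverse-involutive xs))

module ReturnWords {A : Set a} (_≟_ : DecidableEquality A)
                   {S : Language A ℓ} (factorial : Factorial S) (w : List A) where

  -- Membership in `S` is left out to keep both predicates decidable. The `p` of `Returnˡ` lists its
  -- letters outward from `w`, so that `First` and `cut` serve on both sides.
  Returnʳ Returnˡ : Pred (List A) a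
  Returnʳ s = s ≢ [] × ∃[ y ] w ++ s ≡ y ++ w
  Returnˡ p = p ≢ [] × ∃[ s ] p ʳ++ w ≡ w ++ s

  returnʳ? : Decidable Returnʳ
  returnʳ? s = nonempty? s ×-dec suffix? _≟_ w (w ++ s)

  returnˡ? : Decidable Returnˡ
  returnˡ? p = nonempty? p ×-dec prefix? _≟_ w (p ʳ++ w)

  -- The word y w = w s contains w exactly twice, as a proper prefix and as a proper suffix.
  record Complete (y s : List A) : Set a where
    field
      equation : w ++ s ≡ y ++ w
      y≢[]     : y ≢ []
      ends     : ∀ α δ → y ++ w ≡ α ++ (w ++ δ) → α ≡ [] ⊎ δ ≡ []

  open Complete

  y≡[]⇒s≡[] : ∀ {y s} → w ++ s ≡ y ++ w → y ≡ [] → s ≡ []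
  y≡[]⇒s≡[] eq refl = ++-identityʳ-unique w (sym eq)

  s≡[]⇒y≡[] : ∀ {y s} → w ++ s ≡ y ++ w → s ≡ [] → y ≡ []
  s≡[]⇒y≡[] {y} eq refl = ++-identityˡ-unique y (trans (sym (++-identityʳ w)) eq)

  -- Let `w` occur after a nonempty `α`. If `α ++ w` reaches beyond the initial `w`, it cuts off a
  -- return prefix of `s`, which minimality makes all of `s`; otherwise a longer word would fit
  -- inside `w`.
  firstʳ⇒complete : ∀ {s} → First Returnʳ s → ∃[ y ] Complete y s
  firstʳ⇒complete {s} ((s≢[] , y , eq) , minimal) = y , record
    { equation = eq
    ; y≢[]     = s≢[] ∘ y≡[]⇒s≡[] eq
    ; ends     = λ α δ eq′ → ends′ α δ (trans eq (trans eq′ (sym (++-assoc α w δ))))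
    }
    where
    ends′ : ∀ α δ → w ++ s ≡ (α ++ w) ++ δ → α ≡ [] ⊎ δ ≡ []
    ends′ [] δ _ = inj₁ refl
    ends′ α@(_ ∷ _) δ eq′ with levi w eq′
    ... | inj₁ (t , αw≡wt , s≡tδ) = inj₂ (minimal s≡tδ
      ((λ t≡[] → contradiction (s≡[]⇒y≡[] (sym αw≡wt) t≡[]) λ ()) , α , sym αw≡wt))
    ... | inj₂ (t , w≡αwt , _) = inj₁ (proj₁ (sandwich w α (trans w≡αwt (++-assoc α w t))))

  complete⇒firstʳ : ∀ {y s} → Complete y s → First Returnʳ s
  complete⇒firstʳ {y} {s} c = (y≢[] c ∘ s≡[]⇒y≡[] (equation c) , y , equation c) , minimal
    where
    minimal : ∀ {t u} → s ≡ t ++ u → Returnʳ t → u ≡ []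
    minimal {t} {u} refl (t≢[] , y′ , eq) with ends c y′ u (begin
      y ++ w        ≡⟨ equation c ⟨
      w ++ (t ++ u) ≡⟨ ++-assoc w t u ⟨
      (w ++ t) ++ u ≡⟨ cong (_++ u) eq ⟩
      (y′ ++ w) ++ u ≡⟨ ++-assoc y′ w u ⟩
      y′ ++ (w ++ u) ∎)
      where open ≡-Reasoning
    ... | inj₁ y′≡[] = contradiction (y≡[]⇒s≡[] eq y′≡[]) t≢[]
    ... | inj₂ u≡[]  = u≡[]

  -- The mirror argument: an occurrence of `w` that starts strictly inside `reverse p` gives a left
  -- return word that is a prefix of `p`, hence `p` itself, so `α` is empty.
  firstˡ⇒complete : ∀ {p} → First Returnˡ p → ∃[ s ] Complete (reverse p) s
  firstˡ⇒complete {p} ((p≢[] , s , eq) , minimal) = s , record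
    { equation = trans (sym eq) (ʳ++-defn p)
    ; y≢[]     = p≢[] ∘ reverse-≡[]
    ; ends     = ends′
    }
    where
    ends′ : ∀ α δ → reverse p ++ w ≡ α ++ (w ++ δ) → α ≡ [] ⊎ δ ≡ []
    ends′ α δ eq′ with levi (reverse p) {zs = α} eq′
    ... | inj₁ (t , _ , w≡twδ) = inj₂ (proj₂ (sandwich w t w≡twδ))
    ... | inj₂ ([] , _ , wδ≡w) = inj₂ (++-identityʳ-unique w (sym wδ≡w))
    ... | inj₂ (t@(_ ∷ _) , p≡αt , wδ≡tw) = inj₁ (reverse-≡[] (minimal
      (trans (sym (reverse-involutive p)) (trans (cong reverse p≡αt) (reverse-++ α t)))
      ((λ eq → contradiction (reverse-≡[] {xs = t} eq) λ ()) , δ , trans (reverse-ʳ++ t) (sym wδ≡tw))))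

  complete⇒firstˡ : ∀ {y s} → Complete y s → First Returnˡ (reverse y)
  complete⇒firstˡ {y} {s} c =
    (y≢[] c ∘ reverse-≡[] , s , trans (reverse-ʳ++ y) (sym (equation c))) , minimal
    where
    minimal : ∀ {t u} → reverse y ≡ t ++ u → Returnˡ t → u ≡ []
    minimal {t} {u} y≡tu (t≢[] , s′ , eq) with ends c (reverse u) s′ (begin
      y ++ w                   ≡⟨ reverse-ʳ++ y ⟨
      reverse y ʳ++ w          ≡⟨ cong (_ʳ++ w) y≡tu ⟩
      (t ++ u) ʳ++ w           ≡⟨ ++-ʳ++ t ⟩
      u ʳ++ (t ʳ++ w)          ≡⟨ cong (u ʳ++_) eq ⟩
      u ʳ++ (w ++ s′)          ≡⟨ ʳ++-defn u ⟩
      reverse u ++ (w ++ s′)   ∎)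
      where open ≡-Reasoning
    ... | inj₁ u≡[]  = reverse-≡[] u≡[]
    ... | inj₂ s′≡[] = contradiction
      (reverse-≡[] (s≡[]⇒y≡[] (trans (sym eq) (ʳ++-defn t)) s′≡[])) t≢[]

  private
    return : ∀ {s} → w ++ s ∈ S → Returnʳ s → ReturnWord S w s
    return ws∈S (s≢[] , y , eq) =
      suffix-closed factorial w ws∈S , ws∈S , y , w , s≢[] ∘ y≡[]⇒s≡[] eq , refl , eq

  -- `FirstReturnWord` excludes only prefixes that return within `S`, but factoriality puts `w ++ t`
  -- in `S` for every prefix `t` of `s`.
  firstReturnWord⇒firstʳ : ∀ {s} → FirstReturnWord S w s → First Returnʳ s
  firstReturnWord⇒firstʳ {s} ((s∈S , ws∈S , y , _ , y≢[] , refl , eq) , ¬longer) =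
    (y≢[] ∘ s≡[]⇒y≡[] eq , y , eq) , minimal
    where
    minimal : ∀ {t u} → s ≡ t ++ u → Returnʳ t → u ≡ []
    minimal {t} {[]}    _    _ = refl
    minimal {t} {u@(_ ∷ _)} s≡tu t-returns =
      contradiction (t , u , return wt∈S t-returns , (λ ()) , s≡tu) ¬longer
      where
      wt∈S : w ++ t ∈ S
      wt∈S = prefix-closed factorial u (subst S (trans (cong (w ++_) s≡tu) (sym (++-assoc w t u))) ws∈S)

  firstʳ⇒firstReturnWord : ∀ {s} → w ++ s ∈ S → First Returnʳ s → FirstReturnWord S w s
  firstʳ⇒firstReturnWord ws∈S (returns , minimal) = return ws∈S returns , longer
    where
    longer : ¬ (ReturnWord S w · (A ⁺)) _
    longer (t , u , (_ , _ , y , _ , y≢[] , refl , eq) , u≢[] , s≡tu) =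
      u≢[] (minimal s≡tu (y≢[] ∘ s≡[]⇒y≡[] eq , y , eq))

  firstReturnWord-prefix : ∀ {s t u v} → FirstReturnWord S w s → FirstReturnWord S w t →
                           s ++ u ≡ t ++ v → s ≡ t
  firstReturnWord-prefix {s} {t} s∈ t∈ eq with levi s eq
  ... | inj₁ (x , t≡sx , _)
    with refl ← proj₂ (firstReturnWord⇒firstʳ t∈) t≡sx (proj₁ (firstReturnWord⇒firstʳ s∈)) =
      sym (trans t≡sx (++-identityʳ s))
  ... | inj₂ (x , s≡tx , _)
    with refl ← proj₂ (firstReturnWord⇒firstʳ s∈) s≡tx (proj₁ (firstReturnWord⇒firstʳ t∈)) =
      trans s≡tx (++-identityʳ t)

  -- Truncated codes that contain the first return words

  module Bounded (n : ℕ) (occurs : ∀ {v} → v ∈ S → length v ≡ n → w isFactorOf v) where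

    private
      -- An occurrence of `w` is sought after the first letter, so that the return found is nonempty
      -- even when `w` is empty; hence `suc n`.
      barʳ : ∀ {s} → w ++ s ∈ S → length s ≡ suc n → ∃₂ λ t u → s ≡ t ++ u × Returnʳ t
      barʳ {x ∷ s} ws∈S len
        with toView (occurs (suffix-closed factorial [ x ] (suffix-closed factorial w ws∈S))
                            (suc-injective len))
      ... | MkView α w≈ δ with refl ← Pointwise-≡⇒≡ w≈ =
        x ∷ (α ++ w) , δ , cong (x ∷_) (sym (++-assoc α w δ)) ,
        (λ ()) , w ++ (x ∷ α) , sym (++-assoc w (x ∷ α) w)

      barˡ : ∀ {p} → p ʳ++ w ∈ S → length p ≡ suc n → ∃₂ λ t u → p ≡ t ++ u × Returnˡ t
      barˡ {x ∷ p} pw∈S len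
        with reverse p in eq
           | toView (occurs (prefix-closed factorial (x ∷ w) (subst S (ʳ++-defn p) pw∈S))
                            (trans (length-reverse p) (suc-injective len)))
      ... | _ | MkView α w≈ δ with refl ← Pointwise-≡⇒≡ w≈ =
        x ∷ (reverse δ ++ reverse w) , reverse α , cong (x ∷_) p≡ , (λ ()) , δ ++ (x ∷ w) , (begin
          (reverse δ ++ reverse w) ʳ++ (x ∷ w)   ≡⟨ ++-ʳ++ (reverse δ) ⟩
          reverse w ʳ++ (reverse δ ʳ++ (x ∷ w))  ≡⟨ reverse-ʳ++ w ⟩
          w ++ (reverse δ ʳ++ (x ∷ w))           ≡⟨ cong (w ++_) (reverse-ʳ++ δ) ⟩
          w ++ (δ ++ (x ∷ w))                    ∎)
        where
        open ≡-Reasoning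
        p≡ : p ≡ (reverse δ ++ reverse w) ++ reverse α
        p≡ = begin
          p                                    ≡⟨ reverse-involutive p ⟨
          reverse (reverse p)                  ≡⟨ cong reverse eq ⟩
          reverse (α ++ (w ++ δ))              ≡⟨ reverse-++ α (w ++ δ) ⟩
          reverse (w ++ δ) ++ reverse α        ≡⟨ cong (_++ reverse α) (reverse-++ w δ) ⟩
          (reverse δ ++ reverse w) ++ reverse α ∎

    codeʳ codeˡ : Code A
    codeʳ = cut returnʳ? (suc n)
    codeˡ = cut returnˡ? (suc n)

    leafʳ : (l : Leaf codeʳ) → w ++ word codeʳ l ∈ S → FirstReturnWord S w (word codeʳ l)
    leafʳ l wl∈S = firstʳ⇒firstReturnWord wl∈S (leaf-first returnʳ? (suc n) l (barʳ wl∈S))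

    -- A first left and a first right return word are the two ways of reading one complete return
    -- word, so `Complete` carries one to the other.
    leafˡ : (l : Leaf codeˡ) → word codeˡ l ʳ++ w ∈ S →
            ∃[ s ] FirstReturnWord S w s × w ++ s ≡ word codeˡ l ʳ++ w
    leafˡ l lw∈S with firstˡ⇒complete (leaf-first returnˡ? (suc n) l (barˡ lw∈S))
    ... | s , c = s , firstʳ⇒firstReturnWord (subst S (sym eq) lw∈S) (complete⇒firstʳ c) , eq
      where
      eq : w ++ s ≡ word codeˡ l ʳ++ w
      eq = trans (equation c) (sym (ʳ++-defn (word codeˡ l)))

    fromFirstʳ : ∀ {s} → FirstReturnWord S w s → ∃[ l ] word codeʳ l ≡ s
    fromFirstʳ {s} s∈@((_ , ws∈S , _) , _) =
      first-leaf returnʳ? (suc n) (first-bounded bar first) first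
      where
      first : First Returnʳ s
      first = firstReturnWord⇒firstʳ s∈

      bar : ∀ {t u} → s ≡ t ++ u → length t ≡ suc n → ∃₂ λ t′ u′ → t ≡ t′ ++ u′ × Returnʳ t′
      bar {t} {u} s≡tu = barʳ (prefix-closed factorial u
        (subst S (trans (cong (w ++_) s≡tu) (sym (++-assoc w t u))) ws∈S))

    fromFirstˡ : ∀ {s} → FirstReturnWord S w s → ∃[ l ] w ++ s ≡ word codeˡ l ʳ++ w
    fromFirstˡ {s} s∈@((_ , ws∈S , _) , _) with firstʳ⇒complete (firstReturnWord⇒firstʳ s∈)
    ... | y , c with first-leaf returnˡ? (suc n) (first-bounded bar first) first
      where
      first : First Returnˡ (reverse y)
      first = complete⇒firstˡ c

      bar : ∀ {t u} → reverse y ≡ t ++ u → length t ≡ suc n → ∃₂ λ t′ u′ → t ≡ t′ ++ u′ × Returnˡ t′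
      bar {t} {u} y≡tu = barˡ (ʳ++-closed factorial u (subst S (begin
        w ++ s           ≡⟨ equation c ⟩
        y ++ w           ≡⟨ reverse-ʳ++ y ⟨
        reverse y ʳ++ w  ≡⟨ cong (_ʳ++ w) y≡tu ⟩
        (t ++ u) ʳ++ w   ≡⟨ ++-ʳ++ t ⟩
        u ʳ++ (t ʳ++ w)  ∎) ws∈S))
        where open ≡-Reasoning
    ... | l , eq = l , trans (equation c) (trans (sym (reverse-ʳ++ y)) (cong (_ʳ++ w) (sym eq)))

-- Derived sets

module Derivation {A : Set a} {B : Set b} (_≟_ : DecidableEquality A)
                  (S : Language A ℓ) (ut : UniformlyRecurrentTreeSet S) (w : List A) (w∈S : w ∈ S)
                  (f : List B → List A) (coding : IsCodingMorphism (FirstReturnWord S w) f) where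
  open UniformlyRecurrentTreeSet ut
  open UniformlyRecurrent uniformlyRecurrent using (recurrent)
  open TreeSet treeSet
  open IsCodingMorphism coding
  open IsMonoidHomomorphism isMonoidHomomorphism using (homo; ε-homo)
  open CodeTrees _≟_ treeSet
  open ReturnWords _≟_ factorial w
  open Bounded (proj₁ (recurrent w∈S)) (proj₂ (proj₂ (recurrent w∈S)))

  private
    T : Language B ℓ
    T = DerivedSet S w f

  f-∷ : ∀ β x → f (β ∷ x) ≡ f [ β ] ++ f x
  f-∷ β x = homo [ β ] x

  complete : ∀ β → ∃[ y ] Complete y (f [ β ])
  complete β = firstʳ⇒complete (firstReturnWord⇒firstʳ (into β))

  f-letter≢[] : ∀ β → f [ β ] ≢ []
  f-letter≢[] β = proj₁ (proj₁ (firstReturnWord⇒firstʳ (into β)))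

  -- Trades `f [ β ]` for the left return word `y`, which keeps `w` directly before `f x` in
  -- inductions on `x`.
  shift : ∀ {β y} → Complete y (f [ β ]) → ∀ x → w ++ f (β ∷ x) ≡ y ++ (w ++ f x)
  shift {β} {y} c x = begin
    w ++ f (β ∷ x)        ≡⟨ cong (w ++_) (f-∷ β x) ⟩
    w ++ (f [ β ] ++ f x) ≡⟨ ++-assoc w _ _ ⟨
    (w ++ f [ β ]) ++ f x ≡⟨ cong (_++ f x) (Complete.equation c) ⟩
    (y ++ w) ++ f x       ≡⟨ ++-assoc y w _ ⟩
    y ++ (w ++ f x)       ∎
    where open ≡-Reasoning

  f-ends : ∀ x → ∃[ y ] w ++ f x ≡ y ++ w
  f-ends []      = [] , trans (cong (w ++_) ε-homo) (++-identityʳ w)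
  f-ends (β ∷ x) with complete β | f-ends x
  ... | y , c | z , eq = y ++ z , trans (shift c x) (trans (cong (y ++_) eq) (sym (++-assoc y z w)))

  length-f : ∀ x → length x ≤ length (f x)
  length-f []      = z≤n
  length-f (β ∷ x) = ≤-trans (+-mono-≤ (1≤length (f-letter≢[] β)) (length-f x))
    (≤-reflexive (sym (trans (cong length (f-∷ β x)) (length-++ (f [ β ])))))
    where
    1≤length : ∀ {xs : List A} → xs ≢ [] → 1 ≤ length xs
    1≤length {[]}    ≢[] = contradiction refl ≢[]
    1≤length {_ ∷ _} _   = s≤s z≤n

  -- The occurrences of w in w f(x) are the obvious ones, since f(β) contributes exactly one.
  occurrence : ∀ x α δ → w ++ f x ≡ α ++ (w ++ δ) → ∃₂ λ x₁ x₂ → x ≡ x₁ ++ x₂ × f x₂ ≡ δ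
  occurrence []      α δ eq =
    [] , [] , refl , trans ε-homo (sym (proj₂ (sandwich w α (trans (sym (proj₂ (f-ends []))) eq))))
  occurrence (β ∷ x) α δ eq with complete β
  ... | y , c with levi y (trans (sym (shift c x)) eq)
  -- The occurrence starts at or after the end of `y`, so it lies in `w ++ f x`.
  ...   | inj₁ (α′ , _ , eq′) with occurrence x α′ δ eq′
  ...     | x₁ , x₂ , x≡ , fx₂≡δ = β ∷ x₁ , x₂ , cong (β ∷_) x≡ , fx₂≡δ
  occurrence (β ∷ x) α δ eq | y , c | inj₂ (t , y≡αt , wδ≡twf)
    with levi w (trans wδ≡twf (sym (++-assoc t w (f x))))
  ... | inj₂ (δ′ , w≡twδ′ , fx≡δ′δ)
    with refl ← proj₂ (sandwich w t (trans w≡twδ′ (++-assoc t w δ′))) = [ β ] , x , refl , fx≡δ′δ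
  -- Now the occurrence lies within `y ++ w`, so `ends` makes it the first or the last copy of `w`
  -- there.
  ... | inj₁ (δ′ , tw≡wδ′ , δ≡δ′f)
    with Complete.ends c α δ′ (trans (cong (_++ w) y≡αt) (trans (++-assoc α t w) (cong (α ++_) tw≡wδ′)))
  ...   | inj₁ refl = [] , β ∷ x , refl , ++-cancelˡ w _ _ eq
  ...   | inj₂ refl = [ β ] , x , refl , sym δ≡δ′f

  -- Decoding letter by letter: first return words form a prefix code, and `f` is injective on
  -- letters.
  f-prefix : ∀ u x δ → f x ≡ f u ++ δ → ∃[ v ] x ≡ u ++ v
  f-prefix []      x       δ eq = x , refl
  f-prefix (β ∷ u) []      δ eq =
    contradiction (++-conicalˡ (f [ β ]) (f u) (trans (sym (f-∷ β u)) f[βu]≡[])) (f-letter≢[] β)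
    where
    f[βu]≡[] : f (β ∷ u) ≡ []
    f[βu]≡[] = ++-conicalˡ (f (β ∷ u)) δ (trans (sym eq) ε-homo)
  f-prefix (β ∷ u) (γ ∷ x) δ eq =
    peel (injective (firstReturnWord-prefix (into γ) (into β) factored))
    where
    open ≡-Reasoning
    factored : f [ γ ] ++ f x ≡ f [ β ] ++ (f u ++ δ)
    factored = begin
      f [ γ ] ++ f x          ≡⟨ f-∷ γ x ⟨
      f (γ ∷ x)               ≡⟨ eq ⟩
      f (β ∷ u) ++ δ          ≡⟨ cong (_++ δ) (f-∷ β u) ⟩
      (f [ β ] ++ f u) ++ δ   ≡⟨ ++-assoc (f [ β ]) (f u) δ ⟩
      f [ β ] ++ (f u ++ δ)   ∎

    peel : γ ≡ β → ∃[ v ] γ ∷ x ≡ β ∷ u ++ v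
    peel refl with f-prefix u x δ (++-cancelˡ (f [ γ ]) _ _ factored)
    ... | v , x≡uv = v , cong (γ ∷_) x≡uv

  -- The `w` in front synchronises: by `occurrence` it sits at a boundary between letters of `v`,
  -- and from there `f-prefix` decodes `u`.
  f-factor : ∀ {u v s} → s ≡ w ++ f v → (w ++ f u) isFactorOf s → u isFactorOf v
  f-factor {u} {v} s≡wfv wfu⊑s with toView wfu⊑s
  ... | MkView α wfu≈ δ with refl ← Pointwise-≡⇒≡ wfu≈
    with occurrence v α (f u ++ δ) (trans (sym s≡wfv) (cong (α ++_) (++-assoc w (f u) δ)))
  ... | v₁ , v₂ , refl , eq with f-prefix u v₂ δ eq
  ...   | v₃ , refl = fromView (MkView v₁ (≡⇒Pointwise-≡ refl) v₃)

  -- Factoriality, extendability and recurrence of the derived set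

  T-nonempty : [] ∈ T
  T-nonempty = subst S (sym (proj₂ (f-ends []))) w∈S

  -- Since `w ++ f p` ends in `w`, the word `w ++ f u` is a factor of `w ++ f (p ++ (u ++ s))`.
  T-factorial : Factorial T
  T-factorial x∈T u⊑x with toView u⊑x
  ... | MkView p {u} u≈ s with refl ← Pointwise-≡⇒≡ u≈ | f-ends p
  ...   | y , wfp≡yw = infix-closed factorial y (w ++ f u) (f s) (subst S (begin
    w ++ f (p ++ (u ++ s))       ≡⟨ cong (w ++_) (homo p (u ++ s)) ⟩
    w ++ (f p ++ f (u ++ s))     ≡⟨ ++-assoc w _ _ ⟨
    (w ++ f p) ++ f (u ++ s)     ≡⟨ cong₂ _++_ wfp≡yw (homo u s) ⟩
    (y ++ w) ++ (f u ++ f s)     ≡⟨ ++-assoc y w _ ⟩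
    y ++ (w ++ (f u ++ f s))     ≡⟨ cong (y ++_) (++-assoc w _ _) ⟨
    y ++ ((w ++ f u) ++ f s)     ∎) x∈T)
    where open ≡-Reasoning

  private
    return-suffix : ∀ x {s} → (w ++ f x) ++ s ∈ S → w ++ s ∈ S
    return-suffix x {s} e with f-ends x
    ... | y , eq = suffix-closed factorial y (subst S (trans (cong (_++ s) eq) (++-assoc y w s)) e)

    f-∷ʳ : ∀ x γ → w ++ f (x ∷ʳ γ) ≡ (w ++ f x) ++ f [ γ ]
    f-∷ʳ x γ = trans (cong (w ++_) (homo x [ γ ])) (sym (++-assoc w _ _))

    f-∷ˡ : ∀ {β} (l : Leaf codeˡ) → w ++ f [ β ] ≡ word codeˡ l ʳ++ w → ∀ x →
           w ++ f (β ∷ x) ≡ word codeˡ l ʳ++ (w ++ f x)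
    f-∷ˡ {β} l eq x = begin
      w ++ f (β ∷ x)               ≡⟨ cong (w ++_) (f-∷ β x) ⟩
      w ++ (f [ β ] ++ f x)        ≡⟨ ++-assoc w _ _ ⟨
      (w ++ f [ β ]) ++ f x        ≡⟨ cong (_++ f x) eq ⟩
      (word codeˡ l ʳ++ w) ++ f x  ≡⟨ ʳ++-++-assoc (word codeˡ l) ⟩
      word codeˡ l ʳ++ (w ++ f x)  ∎
      where open ≡-Reasoning

  letterʳ : ∀ x (l : Leaf codeʳ) → (w ++ f x) ++ word codeʳ l ∈ S → ∃[ γ ] f [ γ ] ≡ word codeʳ l
  letterʳ x l e = onto (leafʳ l (return-suffix x e))

  letterˡ : ∀ {s} (l : Leaf codeˡ) → word codeˡ l ʳ++ (w ++ s) ∈ S →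
            ∃[ β ] w ++ f [ β ] ≡ word codeˡ l ʳ++ w
  letterˡ {s} l e with leafˡ l (prefix-closed factorial s (subst S (sym (ʳ++-++-assoc (word codeˡ l))) e))
  ... | r , r∈ , eq with onto r∈
  ...   | β , refl = β , eq

  -- The word `w ++ f x` extends in `S` to a leaf of `codeʳ`. As `w ++ f x` ends in `w`, that leaf
  -- is a first return word and so the image of a letter.
  T-extendʳ : ∀ {x} → x ∈ T → ∃[ γ ] x ∷ʳ γ ∈ T
  T-extendʳ {x} x∈T with extendʳ codeʳ x∈T
  ... | l , e with letterʳ x l e
  ...   | γ , eq = γ , subst S (sym (trans (f-∷ʳ x γ) (cong ((w ++ f x) ++_) eq))) e

  T-extendˡ : ∀ {x} → x ∈ T → ∃[ β ] β ∷ x ∈ T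
  T-extendˡ {x} x∈T with extendˡ codeˡ x∈T
  ... | l , e with letterˡ l e
  ...   | β , eq = β , subst S (sym (f-∷ˡ l eq x)) e

  T-recurrent : ∀ {u} → u ∈ T → ∃[ n ] 1 ≤ n × (∀ {v} → v ∈ T → length v ≡ n → u isFactorOf v)
  T-recurrent {u} u∈T with recurrent u∈T
  -- The bound for `w ++ f u` in `S` serves unchanged: by `length-f` the word `f v` has a prefix of
  -- length `n`.
  ... | n , 1≤n , occurs = n , 1≤n , factor
    where
    factor : ∀ {v} → v ∈ T → length v ≡ n → u isFactorOf v
    factor {v} v∈T len = f-factor refl (w ++ⁱ
      subst ((w ++ f u) isFactorOf_) (take++drop≡id n (f v)) (occurs start∈S len-start ⁱ++ drop n (f v)))
      where
      start∈S : take n (f v) ∈ S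
      start∈S = prefix-closed factorial (drop n (f v))
        (subst S (sym (take++drop≡id n (f v))) (suffix-closed factorial w v∈T))

      len-start : length (take n (f v)) ≡ n
      len-start = trans (length-take n (f v)) (m≤n⇒m⊓n≡m (subst (_≤ length (f v)) len (length-f v)))

  -- Extension graphs of the derived set

  private
    leafOfˡ : B → Leaf codeˡ
    leafOfˡ β = proj₁ (fromFirstˡ (into β))

    leafOfˡ-word : ∀ β → w ++ f [ β ] ≡ word codeˡ (leafOfˡ β) ʳ++ w
    leafOfˡ-word β = proj₂ (fromFirstˡ (into β))

    leafOfʳ : B → Leaf codeʳ
    leafOfʳ γ = proj₁ (fromFirstʳ (into γ))

    leafOfʳ-word : ∀ γ → word codeʳ (leafOfʳ γ) ≡ f [ γ ]
    leafOfʳ-word γ = proj₂ (fromFirstʳ (into γ))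

    leafOfˡ-injective : ∀ {β β′} → leafOfˡ β ≡ leafOfˡ β′ → β ≡ β′
    leafOfˡ-injective {β} {β′} eq = injective (++-cancelˡ w _ _ (trans (leafOfˡ-word β)
      (trans (cong (λ l → word codeˡ l ʳ++ w) eq) (sym (leafOfˡ-word β′)))))

    leafOfʳ-injective : ∀ {γ γ′} → leafOfʳ γ ≡ leafOfʳ γ′ → γ ≡ γ′
    leafOfʳ-injective {γ} {γ′} eq = injective (trans (sym (leafOfʳ-word γ))
      (trans (cong (word codeʳ) eq) (leafOfʳ-word γ′)))

    leafOfˡ-unique : ∀ {β} l → w ++ f [ β ] ≡ word codeˡ l ʳ++ w → leafOfˡ β ≡ l
    leafOfˡ-unique {β} l eq = word-injective codeˡ (reverse-injective (++-cancelʳ w _ _ (begin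
      reverse (word codeˡ (leafOfˡ β)) ++ w ≡⟨ ʳ++-defn (word codeˡ (leafOfˡ β)) ⟨
      word codeˡ (leafOfˡ β) ʳ++ w          ≡⟨ leafOfˡ-word β ⟨
      w ++ f [ β ]                          ≡⟨ eq ⟩
      word codeˡ l ʳ++ w                    ≡⟨ ʳ++-defn (word codeˡ l) ⟩
      reverse (word codeˡ l) ++ w           ∎)))
      where open ≡-Reasoning

    leafOf-extends : ∀ x β γ → w ++ f (β ∷ (x ∷ʳ γ)) ≡
                     word codeˡ (leafOfˡ β) ʳ++ ((w ++ f x) ++ word codeʳ (leafOfʳ γ))
    leafOf-extends x β γ = begin
      w ++ f (β ∷ (x ∷ʳ γ))
        ≡⟨ f-∷ˡ (leafOfˡ β) (leafOfˡ-word β) (x ∷ʳ γ) ⟩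
      word codeˡ (leafOfˡ β) ʳ++ (w ++ f (x ∷ʳ γ))
        ≡⟨ cong (word codeˡ (leafOfˡ β) ʳ++_) (f-∷ʳ x γ) ⟩
      word codeˡ (leafOfˡ β) ʳ++ ((w ++ f x) ++ f [ γ ])
        ≡⟨ cong (λ s → word codeˡ (leafOfˡ β) ʳ++ ((w ++ f x) ++ s)) (leafOfʳ-word γ) ⟨
      word codeˡ (leafOfˡ β) ʳ++ ((w ++ f x) ++ word codeʳ (leafOfʳ γ)) ∎
      where open ≡-Reasoning

  derived-tree : ∀ x → Tree (Extends T x)
  derived-tree x = embedded-tree leafOfˡ leafOfʳ leafOfˡ-injective leafOfʳ-injective
    (subst S (leafOf-extends x _ _)) from (code-tree codeˡ codeʳ (w ++ f x))
    where
    -- An edge places both leaf words next to a copy of `w` inside a word of `S`, so both come from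
    -- letters of `B`; leaves outside the image are thus isolated.
    from : ∀ {l m} → word codeˡ l ʳ++ ((w ++ f x) ++ word codeʳ m) ∈ S →
           ∃₂ λ β γ → leafOfˡ β ≡ l × leafOfʳ γ ≡ m × Extends T x β γ
    from {l} {m} e
      with letterˡ l (subst (λ s → word codeˡ l ʳ++ s ∈ S) (++-assoc w (f x) _) e)
         | letterʳ x m (ʳ++-closed factorial (word codeˡ l) e)
    ... | β , eqˡ | γ , eqʳ
      with refl ← leafOfˡ-unique l eqˡ
         | refl ← word-injective codeʳ {leafOfʳ γ} {m} (trans (leafOfʳ-word γ) eqʳ) =
      β , γ , refl , refl , subst S (sym (leafOf-extends x β γ)) e

  derived-treeSet : TreeSet T
  derived-treeSet = record
    { factorial    = T-factorial
    ; biextendable = λ x∈T →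
        let γ , xγ∈T = T-extendʳ x∈T
            β , βxγ∈T = T-extendˡ {_ ∷ʳ γ} xγ∈T
        in β , γ , βxγ∈T
    ; trees        = λ {x} _ → tree-extension T x
        (λ {β} → T-extendʳ {β ∷ x}) (λ {γ} → T-extendˡ {x ∷ʳ γ}) (derived-tree x)
    }

  derived-uniformlyRecurrent : UniformlyRecurrent T
  derived-uniformlyRecurrent = record
    { nonempty        = [] , T-nonempty
    ; factorial       = T-factorial
    ; rightExtendable = λ {x} → T-extendʳ {x}
    ; recurrent       = T-recurrent
    }

theorem5p13 : ∀ {a b ℓ : Level} {A : Set a} {B : Set b} (k : ℕ) → A ↔ Fin (suc k) →
    (S : Language A ℓ) → UniformlyRecurrentTreeSet S →
    (w : List A) → w ∈ S →
    (f : List B → List A) → IsCodingMorphism (FirstReturnWord S w) f →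
    UniformlyRecurrentTreeSet (DerivedSet S w f)
theorem5p13 k A↔Fin S ut w w∈S f coding = record
  { uniformlyRecurrent = derived-uniformlyRecurrent
  ; treeSet            = derived-treeSet
  }
  where open Derivation (via-injection (↔⇒↣ A↔Fin) Fin._≟_) S ut w w∈S f coding
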